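{- Let $A$ be a finite subset of $\mathbb{Z}$ containing at least two points. Then the smallest possible size of a percolating seed $S \subseteq \mathbb{Z}$ for the collection of patterns $\{A\}$ in dimension $d = 1$ equals $\operatorname{vol}(\operatorname{conv} A)$, the length of the convex hull of $A$ (that is, $\max A - \min A$).
   Context: Let $d$ be a positive integer and let $\mathcal{A}$ be a finite collection of finite subsets of $\mathbb{Z}^d$, called patterns. A seed is any subset $S$ of $\mathbb{Z}^d$, finite or infinite. Consider the following process. At each moment, every point of $\mathbb{Z}^d$ is either occupied or vacant; initially exactly the points of $S$ are occupied. A point completes a subset of $\mathbb{Z}^d$ if it is the unique vacant point in that subset. On each step, all vacant points which complete a translation copy (by a vector of $\mathbb{Z}^d$) of some pattern in $\mathcal{A}$ become occupied simultaneously; once a point is occupied it stays occupied. The seed $S$ percolates (is a percolating seed for $\mathcal{A}$) if every point of $\mathbb{Z}^d$ eventually becomes occupied. $\operatorname{conv} A$ denotes the convex hull in $\mathbb{R}^d$ and $\operatorname{vol}$ denotes $d$-dimensional volume. -}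

module Defs where

open import Data.Integer using (ℤ; _+_; _-_; ∣_∣)
open import Data.Integer.Properties using (≤-totalOrder)
open import Data.List using (List; []; _∷_; length; map)
open import Data.List.Extrema ≤-totalOrder using (max; min)
open import Data.List.Membership.Propositional using (_∈_)
open import Data.List.Relation.Unary.Unique.Propositional using (Unique)
open import Data.Nat using (ℕ; zero; suc; _≤_)
open import Data.Product using (_×_; ∃-syntax)
open import Data.Sum using (_⊎_)
open import Data.Vec using (Vec; head; zipWith)
open import Level using (0ℓ)
open import Relation.Binary.PropositionalEquality using (_≡_)
open import Relation.Nullary using (¬_)
open import Relation.Unary using (Pred; _≐_)

ℤ^ : ℕ → Set
ℤ^ d = Vec ℤ d

infixl 6 _⊕_
_⊕_ : ∀ {d} → ℤ^ d → ℤ^ d → ℤ^ d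
_⊕_ = zipWith _+_

Subset : Set → Set₁
Subset X = Pred X 0ℓ

record FiniteSubset (X : Set) : Set where
  constructor finiteSubset
  field
    elements : List X
    unique   : Unique elements

open FiniteSubset public

⟦_⟧ : ∀ {X} → FiniteSubset X → Subset X
⟦ F ⟧ x = x ∈ elements F

size : ∀ {X} → FiniteSubset X → ℕ
size F = length (elements F)

HasSize : ∀ {X} → Subset X → ℕ → Set
HasSize {X} S n = ∃[ F ] (S ≐ ⟦ F ⟧ × size F ≡ n)

Pattern : ℕ → Set
Pattern d = FiniteSubset (ℤ^ d)

translate : ∀ {d} → ℤ^ d → Pattern d → Subset (ℤ^ d)
translate v A y = ∃[ a ] (⟦ A ⟧ a × y ≡ a ⊕ v)

-- x is the unique point of T that is vacant, i.e. not in the occupied set O.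
Completes : ∀ {d} → Subset (ℤ^ d) → ℤ^ d → Subset (ℤ^ d) → Set
Completes O x T = T x × ¬ O x × (∀ y → T y → ¬ O y → y ≡ x)

Occupied : ∀ {d} → List (Pattern d) → Subset (ℤ^ d) → ℕ → Subset (ℤ^ d)
Occupied 𝒜 S zero    x = S x
Occupied 𝒜 S (suc t) x =
  Occupied 𝒜 S t x
  ⊎ ∃[ A ] (A ∈ 𝒜 × ∃[ v ] Completes (Occupied 𝒜 S t) x (translate v A))

Percolates : ∀ {d} → List (Pattern d) → Subset (ℤ^ d) → Set
Percolates 𝒜 S = ∀ x → ∃[ t ] Occupied 𝒜 S t x

PercolatingSeedOfSize : ∀ {d} → List (Pattern d) → ℕ → Set₁
PercolatingSeedOfSize 𝒜 n = ∃[ S ] (Percolates 𝒜 S × HasSize S n)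

-- Infinite seeds have no size in ℕ, so they never affect the minimum.
IsSmallestPercolatingSize : ∀ {d} → List (Pattern d) → ℕ → Set₁
IsSmallestPercolatingSize 𝒜 n =
  PercolatingSeedOfSize 𝒜 n × (∀ m → PercolatingSeedOfSize 𝒜 m → n ≤ m)

-- max x xs and min x xs take x into account, so for a nonempty list these are
-- its true maximum and minimum, and ∣_∣ is applied to a nonnegative integer.
spread : List ℤ → ℕ
spread []       = 0
spread (x ∷ xs) = ∣ max x xs - min x xs ∣

-- conv A is the interval [min A , max A] when A is a nonempty subset of ℤ^ 1.
lengthConv : Pattern 1 → ℕ
lengthConv A = spread (map head (elements A))

{-# OPTIONS --safe #-}
-- Upper bound: ℓ consecutive points, ℓ = max A − min A, grow by one point in
-- either direction at every step.  Lower bound: consider 𝔽₂-valued sequences on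
-- ℤ whose sum over every translate of A vanishes.  As the extreme coefficients
-- of this linear recurrence are 1, such a sequence is determined by, and can be
-- prescribed arbitrarily on, ℓ consecutive points.  Two such sequences that
-- agree on a seed agree on every point which eventually becomes occupied, so
-- restriction to a percolating seed of size m is injective and 2 ^ ℓ ≤ 2 ^ m.
module Submission where

open import Defs
import Algebra.Properties.AbelianGroup as AbelianGroupProperties
open import Data.Bool using (Bool; true; false; _xor_; _∧_)
import Data.Bool.Properties as Bool
open import Data.Fin using (Fin; zero; suc; toℕ; fromℕ; fromℕ<; inject₁; combine)
open import Data.Fin.Induction using (<-weakInduction)
import Data.Fin.Properties as Fin
open import Data.Fin.Relation.Unary.Top using (view; ‵fromℕ; ‵inject₁)
open import Data.Integer using (ℤ; +_; -[1+_]; 0ℤ; 1ℤ; _+_; _-_; -_; ∣_∣)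
  renaming (suc to sucℤ; _≤_ to _≤ℤ_)
import Data.Integer.Properties as ℤ
open import Data.Integer.Tactic.RingSolver using (solve-∀)
open import Data.List using (List; []; _∷_; [_]; map)
import Data.List as List
open import Data.List.Extrema ℤ.≤-totalOrder
  using (max; min; xs≤max; ⊥≤max; min≤xs; min≤⊤; argmax-sel; argmin-sel)
import Data.List.Properties as List
open import Data.List.Membership.Propositional using (_∈_; find; lose)
open import Data.List.Membership.Propositional.Properties
  using (∈-tabulate⁺; ∈-map⁺; ∈-map⁻)
import Data.List.Membership.DecPropositional as DecMembership
open import Data.List.Relation.Unary.All as All using (All; all?)
import Data.List.Relation.Unary.AllPairs as AllPairs
open import Data.List.Relation.Unary.Any as Any using (any?; here; there)
open import Data.List.Relation.Unary.Any.Properties using (lookup-index)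
open import Data.List.Relation.Unary.Unique.Propositional.Properties using (tabulate⁺)
open import Data.Nat as ℕ using (ℕ; zero; suc; _^_; _≤_; z≤n; s≤s)
import Data.Nat.Properties as ℕ
open import Data.Product using (_×_; _,_; proj₁; proj₂; ∃-syntax)
open import Data.Sum using (inj₁; inj₂)
open import Data.Vec using (Vec; []; _∷_; head; lookup; tabulate; _∷ʳ_; init; last; initLast; zipWith)
import Data.Vec.Properties as Vec
open import Function using (_∘_; id; Injective; Inverse)
open import Relation.Binary.PropositionalEquality
  using (_≡_; _≢_; refl; sym; trans; cong; cong₂; subst; subst₂; module ≡-Reasoning)
open import Relation.Nullary using (¬_; Dec; yes; no; does; contradiction; ¬?; _×-dec_; _⊎-dec_; _→-dec_)
open import Relation.Nullary.Decidable using (map′; decidable-stable; dec-true)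
open import Relation.Unary using (Decidable)

private
  module ℤ+ = AbelianGroupProperties ℤ.+-0-abelianGroup

-- Decidability of occupation

_≟_ : ∀ {d} (x y : ℤ^ d) → Dec (x ≡ y)
_≟_ = Vec.≡-dec ℤ._≟_

infixl 6 _⊖_
_⊖_ : ∀ {d} → ℤ^ d → ℤ^ d → ℤ^ d
_⊖_ = zipWith _-_

i+j-i≡j : ∀ i j → i + j - i ≡ j
i+j-i≡j = solve-∀

⊕-⊖-cancel : ∀ {d} (a v : ℤ^ d) → (a ⊕ v) ⊖ a ≡ v
⊕-⊖-cancel []      []      = refl
⊕-⊖-cancel (i ∷ a) (j ∷ v) = cong₂ _∷_ (i+j-i≡j i j) (⊕-⊖-cancel a v)

completes? : ∀ {d} {O : Subset (ℤ^ d)} → Decidable O →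
             ∀ x v A → Dec (Completes O x (translate v A))
completes? {O = O} O? x v A = map′ to from
  (any? (λ a → x ≟ (a ⊕ v)) (elements A) ×-dec ¬? (O? x) ×-dec
   all? (λ a → ¬? (O? (a ⊕ v)) →-dec ((a ⊕ v) ≟ x)) (elements A))
  where
  to : _ → Completes O x (translate v A)
  to (p , ¬Ox , q) = find p , ¬Ox , λ { _ (a , a∈A , refl) → All.lookup q a∈A }

  from : Completes O x (translate v A) → _
  from ((a , a∈A , eq) , ¬Ox , q) =
    lose a∈A eq , ¬Ox , All.tabulate (λ {a} a∈A → q (a ⊕ v) (a , a∈A , refl))

-- A translate through `x` sends some `a` of `A` to `x`, which forces the vector `x ⊖ a`; hence only
-- finitely many vectors need testing.
completable? : ∀ {d} {O : Subset (ℤ^ d)} → Decidable O →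
               ∀ x A → Dec (∃[ v ] Completes O x (translate v A))
completable? {O = O} O? x A = map′ to from
  (any? (λ a → completes? O? x (x ⊖ a) A) (elements A))
  where
  to : _ → ∃[ v ] Completes O x (translate v A)
  to p = let a , _ , c = find p in x ⊖ a , c

  from : (∃[ v ] Completes O x (translate v A)) → _
  from (v , c@((a , a∈A , refl) , _)) =
    lose a∈A (subst (λ u → Completes O x (translate u A)) (sym (⊕-⊖-cancel a v)) c)

-- Serves the growth argument: completion asks for a vacant point, so `complete` must first decide
-- whether the point is already occupied.
occupied? : ∀ {d} (𝒜 : List (Pattern d)) {S} → Decidable S →
            ∀ t → Decidable (Occupied 𝒜 S t)
occupied? 𝒜 S? zero    x = S? x
occupied? 𝒜 S? (suc t) x = occupied? 𝒜 S? t x ⊎-dec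
  map′ find (λ (A , A∈𝒜 , p) → lose A∈𝒜 p)
    (any? (completable? (occupied? 𝒜 S? t) x) 𝒜)

-- One-dimensional patterns as subsets of a window

offset : ∀ {n} → ℤ → Fin n → ℤ^ 1
offset i j = (i + + toℕ j) ∷ []

offset-injective : ∀ {n} i {j k : Fin n} → offset i j ≡ offset i k → j ≡ k
offset-injective i eq =
  Fin.toℕ-injective (ℤ.+-injective (ℤ+.∙-cancelˡ i _ _ (Vec.∷-injectiveˡ eq)))

offset-zero : ∀ {n} i → offset {suc n} i zero ≡ i ∷ []
offset-zero i = cong (_∷ []) (ℤ.+-identityʳ i)

offset-suc : ∀ {n} i (j : Fin n) → offset i (suc j) ≡ offset (sucℤ i) j
offset-suc i j = cong (_∷ []) (lemma i (+ toℕ j))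
  where
  lemma : ∀ i k → i + (1ℤ + k) ≡ 1ℤ + i + k
  lemma = solve-∀

offset-inject₁ : ∀ {n} i (j : Fin n) → offset i (inject₁ j) ≡ offset i j
offset-inject₁ i j = cong (λ k → (i + + k) ∷ []) (Fin.toℕ-inject₁ j)

offset-⊕ : ∀ {n} b i (j : Fin n) → offset b j ⊕ (i ∷ []) ≡ offset (b + i) j
offset-⊕ b i j = cong (_∷ []) (lemma b (+ toℕ j) i)
  where
  lemma : ∀ b k i → b + k + i ≡ b + i + k
  lemma = solve-∀

-- Encodes `ℓ = max A - min A`, with `base` the minimum. Indices in `Fin (suc ℓ)` later serve as
-- coefficient positions of the recurrence.
record Spans (A : Pattern 1) (ℓ : ℕ) : Set where
  field
    base   : ℤ
    first∈ : offset {suc ℓ} base zero ∈ elements A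
    last∈  : offset base (fromℕ ℓ) ∈ elements A
    within : ∀ {a} → a ∈ elements A → ∃[ j ] a ≡ offset {suc ℓ} base j

ℤ-rec : (P : ℤ → Set) → P 0ℤ → (∀ i → P i → P (sucℤ i)) → (∀ i → P (sucℤ i) → P i) →
        ∀ i → P i
ℤ-rec P z up down (+ zero)      = z
ℤ-rec P z up down (+ suc n)     = up (+ n) (ℤ-rec P z up down (+ n))
ℤ-rec P z up down -[1+ zero ]   = down -[1+ 0 ] z
ℤ-rec P z up down -[1+ suc n ]  = down -[1+ suc n ] (ℤ-rec P z up down -[1+ n ])

-- Upper bound

module Interval {A : Pattern 1} {k : ℕ} (spans : Spans A (suc k)) where
  open Spans spans

  interval : FiniteSubset (ℤ^ 1)
  interval = finiteSubset (List.tabulate (offset {suc k} 0ℤ)) (tabulate⁺ (offset-injective 0ℤ))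

  Occ : ℕ → Subset (ℤ^ 1)
  Occ = Occupied [ A ] ⟦ interval ⟧

  occ? : ∀ t → Decidable (Occ t)
  occ? = occupied? [ A ] (λ x → DecMembership._∈?_ _≟_ x (elements interval))

  Window : ℤ → ℕ → Set
  Window i t = ∀ (j : Fin (suc k)) → Occ t (offset i j)

  -- The translate by `i - base` stays inside the window starting at `i`, so `offset i e` is its
  -- only point that can still be vacant.
  complete : ∀ i t e → offset base e ∈ elements A →
             (∀ j → j ≢ e → Occ t (offset i j)) → Occ (suc t) (offset i e)
  complete i t e e∈A rest with occ? t (offset i e)
  ... | yes p = inj₁ p
  ... | no ¬p = inj₂ (A , here refl , (i - base) ∷ [] ,
                      (offset base e , e∈A , sym (shift e)) , ¬p , only)
    where
    base+ : ∀ b i → b + (i - b) ≡ i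
    base+ = solve-∀

    shift : ∀ j → offset base j ⊕ ((i - base) ∷ []) ≡ offset i j
    shift j = trans (offset-⊕ base (i - base) j) (cong (λ i → offset i j) (base+ base i))

    only : ∀ y → translate ((i - base) ∷ []) A y → ¬ Occ t y → y ≡ offset i e
    only y (a , a∈A , refl) ¬Oy with j , refl ← within a∈A with j Fin.≟ e
    ... | yes refl = shift e
    ... | no  j≢e  = contradiction (subst (Occ t) (sym (shift j)) (rest j j≢e)) ¬Oy

  -- By `last∈`, the translate of `A` with minimum `i` has its maximum just beyond the window. In
  -- `down`, `first∈` gives the mirror image.
  up : ∀ i t → Window i t → Window (sucℤ i) (suc t)
  up i t w j = subst (Occ (suc t)) (offset-suc i j) (extended (suc j))
    where
    old : ∀ j → Occ t (offset i (inject₁ j))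
    old j = subst (Occ t) (sym (offset-inject₁ i j)) (w j)

    rest : ∀ j → j ≢ fromℕ (suc k) → Occ t (offset i j)
    rest j j≢ with view j
    ... | ‵fromℕ     = contradiction refl j≢
    ... | ‵inject₁ j = old j

    extended : ∀ (j : Fin (suc (suc k))) → Occ (suc t) (offset i j)
    extended j with view j
    ... | ‵fromℕ     = complete i t (fromℕ (suc k)) last∈ rest
    ... | ‵inject₁ j = inj₁ (old j)

  down : ∀ i t → Window (sucℤ i) t → Window i (suc t)
  down i t w j = subst (Occ (suc t)) (offset-inject₁ i j) (extended (inject₁ j))
    where
    old : ∀ j → Occ t (offset i (suc j))
    old j = subst (Occ t) (sym (offset-suc i j)) (w j)

    rest : ∀ j → j ≢ zero → Occ t (offset i j)
    rest zero    j≢ = contradiction refl j≢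
    rest (suc j) _  = old j

    extended : ∀ (j : Fin (suc (suc k))) → Occ (suc t) (offset i j)
    extended zero    = complete i t zero first∈ rest
    extended (suc j) = inj₁ (old j)

  window : ∀ i → ∃[ t ] Window i t
  window = ℤ-rec (λ i → ∃[ t ] Window i t)
    (0 , ∈-tabulate⁺)
    (λ i (t , w) → suc t , up i t w)
    (λ i (t , w) → suc t , down i t w)

  percolates : Percolates [ A ] ⟦ interval ⟧
  percolates (i ∷ []) = let t , w = window i in t , subst (Occ t) (offset-zero {k} i) (w zero)

  seedOfSize : PercolatingSeedOfSize [ A ] (suc k)
  seedOfSize = ⟦ interval ⟧ , percolates , interval , (id , id) ,
               List.length-tabulate (offset {suc k} 0ℤ)

-- Linear algebra over 𝔽₂

xor-cancelˡ : ∀ x {y z} → x xor y ≡ x xor z → y ≡ z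
xor-cancelˡ false eq = eq
xor-cancelˡ true  eq = Bool.not-injective eq

xor-cancelʳ : ∀ x {y z} → y xor x ≡ z xor x → y ≡ z
xor-cancelʳ x {y} {z} eq =
  xor-cancelˡ x (trans (Bool.xor-comm x y) (trans eq (Bool.xor-comm z x)))

dot : ∀ {n} → Vec Bool n → Vec Bool n → Bool
dot []       []       = false
dot (c ∷ cs) (u ∷ us) = (c ∧ u) xor dot cs us

dot-cong : ∀ {n} (c u v : Vec Bool n) →
           (∀ j → lookup c j ≡ true → lookup u j ≡ lookup v j) → dot c u ≡ dot c v
dot-cong []           []       []       eq = refl
dot-cong (false ∷ cs) (u ∷ us) (v ∷ vs) eq = dot-cong cs us vs (eq ∘ suc)
dot-cong (true ∷ cs)  (u ∷ us) (v ∷ vs) eq =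
  cong₂ _xor_ (eq zero refl) (dot-cong cs us vs (eq ∘ suc))

-- Terms other than `e` are either killed by a coefficient 0 or equal on both sides, so they cancel;
-- the coefficient 1 leaves the entry at `e` itself.
dot-cancel : ∀ {n} (c u v : Vec Bool n) e → lookup c e ≡ true →
             (∀ j → j ≢ e → lookup c j ≡ true → lookup u j ≡ lookup v j) →
             dot c u ≡ dot c v → lookup u e ≡ lookup v e
dot-cancel (true ∷ cs) (u ∷ us) (v ∷ vs) zero refl eq d = xor-cancelʳ (dot cs vs)
  (trans (cong (u xor_) (sym (dot-cong cs us vs (λ j → eq (suc j) (λ ()))))) d)
dot-cancel (false ∷ cs) (u ∷ us) (v ∷ vs) (suc e) ce eq d =
  dot-cancel cs us vs e ce (λ j j≢e → eq (suc j) (j≢e ∘ Fin.suc-injective)) d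
dot-cancel (true ∷ cs) (u ∷ us) (v ∷ vs) (suc e) ce eq d
  with refl ← eq zero (λ ()) refl =
  dot-cancel cs us vs e ce (λ j j≢e → eq (suc j) (j≢e ∘ Fin.suc-injective)) (xor-cancelˡ u d)

dot-∷ʳ : ∀ {n} (c u : Vec Bool n) y → dot (c ∷ʳ true) (u ∷ʳ y) ≡ dot c u xor y
dot-∷ʳ []       []       y = Bool.xor-identityʳ y
dot-∷ʳ (c ∷ cs) (u ∷ us) y =
  trans (cong ((c ∧ u) xor_) (dot-∷ʳ cs us y)) (sym (Bool.xor-assoc (c ∧ u) (dot cs us) y))

lookup-∷ʳ-inject₁ : ∀ {a} {X : Set a} {n} (xs : Vec X n) y j →
                    lookup (xs ∷ʳ y) (inject₁ j) ≡ lookup xs j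
lookup-∷ʳ-inject₁ (x ∷ xs) y zero    = refl
lookup-∷ʳ-inject₁ (x ∷ xs) y (suc j) = lookup-∷ʳ-inject₁ xs y j

lookup-∷ʳ-fromℕ : ∀ {a} {X : Set a} {n} (xs : Vec X n) y → lookup (xs ∷ʳ y) (fromℕ n) ≡ y
lookup-∷ʳ-fromℕ []       y = refl
lookup-∷ʳ-fromℕ (x ∷ xs) y = lookup-∷ʳ-fromℕ xs y

tabulate-injective : ∀ {a} {X : Set a} {n} {f g : Fin n → X} →
                     tabulate f ≡ tabulate g → ∀ j → f j ≡ g j
tabulate-injective {f = f} {g} eq j = trans (sym (Vec.lookup∘tabulate f j))
  (trans (cong (λ u → lookup u j) eq) (Vec.lookup∘tabulate g j))

-- Two-sided linear recurrences

module Recurrence {k : ℕ} (c : Vec Bool k) where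

  State : Set
  State = Vec Bool (suc k)

  coefficients : Vec Bool (suc (suc k))
  coefficients = true ∷ (c ∷ʳ true)

  -- A state holds `suc k` consecutive terms. Both end coefficients are 1 and signs vanish over 𝔽₂,
  -- so the relation can be solved for the next term and for the preceding one.
  forward backward : State → State
  forward (x ∷ w) = w ∷ʳ (x xor dot c w)
  backward s      = (last s xor dot c (init s)) ∷ init s

  -- Makes the negative half of an orbit obey the same step rule as the positive half.
  forward-backward : ∀ s → forward (backward s) ≡ s
  forward-backward s = begin
    init s ∷ʳ ((last s xor d) xor d) ≡⟨ cong (init s ∷ʳ_) (xor-twice (last s) d) ⟩
    init s ∷ʳ last s                 ≡⟨ sym (proj₂ (proj₂ (initLast s))) ⟩
    s                                ∎
    where
    open ≡-Reasoning
    d = dot c (init s)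

    xor-twice : ∀ x y → (x xor y) xor y ≡ x
    xor-twice x y = trans (Bool.xor-assoc x y y)
      (trans (cong (x xor_) (Bool.xor-same y)) (Bool.xor-identityʳ x))

  orbit : State → ℤ → State
  orbit s (+ zero)     = s
  orbit s (+ suc n)    = forward (orbit s (+ n))
  orbit s -[1+ zero ]  = backward s
  orbit s -[1+ suc n ] = backward (orbit s -[1+ n ])

  orbit-suc : ∀ s i → orbit s (sucℤ i) ≡ forward (orbit s i)
  orbit-suc s (+ n)        = refl
  orbit-suc s -[1+ zero ]  = sym (forward-backward s)
  orbit-suc s -[1+ suc n ] = sym (forward-backward (orbit s -[1+ n ]))

  sequence : State → ℤ^ 1 → Bool
  sequence s x = head (orbit s (head x))

  lookup-suc : ∀ s (j : Fin k) → lookup s (suc j) ≡ lookup (forward s) (inject₁ j)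
  lookup-suc (x ∷ w) j = sym (lookup-∷ʳ-inject₁ w _ j)

  -- Successive states overlap: entry `suc j` at `i` is entry `inject₁ j` at `sucℤ i`. The induction
  -- on `j` therefore keeps `i` universally quantified.
  lookup-orbit : ∀ s j i → lookup (orbit s i) j ≡ sequence s (offset i j)
  lookup-orbit s = <-weakInduction _ base step
    where
    open ≡-Reasoning

    base : ∀ i → lookup (orbit s i) zero ≡ sequence s (offset {suc k} i zero)
    base i rewrite ℤ.+-identityʳ i with orbit s i
    ... | x ∷ w = refl

    step : ∀ j → (∀ i → lookup (orbit s i) (inject₁ j) ≡ sequence s (offset i (inject₁ j))) →
           ∀ i → lookup (orbit s i) (suc j) ≡ sequence s (offset i (suc j))
    step j ih i = begin
      lookup (orbit s i) (suc j)               ≡⟨ lookup-suc (orbit s i) j ⟩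
      lookup (forward (orbit s i)) (inject₁ j) ≡⟨ cong (λ u → lookup u (inject₁ j)) (orbit-suc s i) ⟨
      lookup (orbit s (sucℤ i)) (inject₁ j)    ≡⟨ ih (sucℤ i) ⟩
      sequence s (offset (sucℤ i) (inject₁ j)) ≡⟨ cong (sequence s) (offset-inject₁ (sucℤ i) j) ⟩
      sequence s (offset (sucℤ i) j)           ≡⟨ cong (sequence s) (offset-suc i j) ⟨
      sequence s (offset i (suc j))            ∎

  -- The terms at 0 to `k` are the state itself, so the sequences have `suc k` free bits.
  sequence-injective : ∀ s u → (∀ x → sequence s x ≡ sequence u x) → s ≡ u
  sequence-injective s u eq = begin
    s                   ≡⟨ Vec.tabulate∘lookup s ⟨
    tabulate (lookup s) ≡⟨ Vec.tabulate-cong same ⟩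
    tabulate (lookup u) ≡⟨ Vec.tabulate∘lookup u ⟩
    u                   ∎
    where
    open ≡-Reasoning

    same : ∀ j → lookup s j ≡ lookup u j
    same j = trans (lookup-orbit s j 0ℤ)
      (trans (eq (offset 0ℤ j)) (sym (lookup-orbit u j 0ℤ)))

  -- Adding the next term gives `suc (suc k)` terms, one for each point of the pattern's window.
  extended : State → Vec Bool (suc (suc k))
  extended s = head s ∷ forward s

  dot-extended : ∀ s → dot coefficients (extended s) ≡ false
  dot-extended (x ∷ w) = begin
    x xor dot (c ∷ʳ true) (w ∷ʳ (x xor d)) ≡⟨ cong (x xor_) (dot-∷ʳ c w (x xor d)) ⟩
    x xor (d xor (x xor d))                ≡⟨ Bool.xor-assoc x d (x xor d) ⟨
    (x xor d) xor (x xor d)                ≡⟨ Bool.xor-same (x xor d) ⟩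
    false                                  ∎
    where
    open ≡-Reasoning
    d = dot c w

  lookup-extended : ∀ s i j → lookup (extended (orbit s i)) j ≡ sequence s (offset i j)
  lookup-extended s i zero    = cong (sequence s) (sym (offset-zero {suc k} i))
  lookup-extended s i (suc j) = begin
    lookup (forward (orbit s i)) j ≡⟨ cong (λ u → lookup u j) (orbit-suc s i) ⟨
    lookup (orbit s (sucℤ i)) j    ≡⟨ lookup-orbit s j (sucℤ i) ⟩
    sequence s (offset (sucℤ i) j) ≡⟨ cong (sequence s) (offset-suc i j) ⟨
    sequence s (offset i (suc j))  ∎
    where open ≡-Reasoning

  -- Both sequences satisfy the same linear relation on the window at `i`, so `dot-cancel` applies
  -- to the coordinate `e`.
  sequence-determined : ∀ s u i e → lookup coefficients e ≡ true →
    (∀ j → j ≢ e → lookup coefficients j ≡ true →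
       sequence s (offset i j) ≡ sequence u (offset i j)) →
    sequence s (offset i e) ≡ sequence u (offset i e)
  sequence-determined s u i e ce eq =
    trans (sym (lookup-extended s i e)) (trans
      (dot-cancel coefficients (extended (orbit s i)) (extended (orbit u i)) e ce
        (λ j j≢e cj → trans (lookup-extended s i j)
          (trans (eq j j≢e cj) (sym (lookup-extended u i j))))
        (trans (dot-extended (orbit s i)) (sym (dot-extended (orbit u i)))))
      (lookup-extended u i e))

-- Counting bit vectors

encode : ∀ {n} → Vec Bool n → Fin (2 ^ n)
encode []       = zero
encode (b ∷ bs) = combine (Inverse.from Fin.2↔Bool b) (encode bs)

encode-injective : ∀ {n} (u v : Vec Bool n) → encode u ≡ encode v → u ≡ v
encode-injective []       []       eq = refl
encode-injective (b ∷ bs) (c ∷ cs) eq =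
  let eq₁ , eq₂ = Fin.combine-injective _ (encode bs) _ (encode cs) eq in
  cong₂ _∷_ (from-injective b c eq₁) (encode-injective bs cs eq₂)
  where
  from-injective : ∀ b c → Inverse.from Fin.2↔Bool b ≡ Inverse.from Fin.2↔Bool c → b ≡ c
  from-injective false false _ = refl
  from-injective true  true  _ = refl

encode-surjective : ∀ n (i : Fin (2 ^ n)) → ∃[ u ] encode {n} u ≡ i
encode-surjective zero    zero = [] , refl
encode-surjective (suc n) i    =
  let j , l , eq = Fin.combine-surjective {2} {2 ^ n} i
      u , eq′    = encode-surjective n l
  in Inverse.to Fin.2↔Bool j ∷ u ,
     trans (cong₂ combine (Inverse.strictlyInverseʳ Fin.2↔Bool j) eq′) eq

-- Pigeonhole on codes: `n < m` would give `2 ^ n < 2 ^ m`, against an injection of `Fin (2 ^ m)`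
-- into `Fin (2 ^ n)`.
bits-injective⇒≤ : ∀ {m n} (f : Vec Bool m → Vec Bool n) → Injective _≡_ _≡_ f → m ≤ n
bits-injective⇒≤ {m} {n} f inj = ℕ.≮⇒≥ λ n<m →
  ℕ.<⇒≱ (ℕ.^-monoʳ-< 2 (s≤s (s≤s z≤n)) n<m) (Fin.injective⇒≤ {f = g} g-injective)
  where
  decode : Fin (2 ^ m) → Vec Bool m
  decode i = proj₁ (encode-surjective m i)

  g : Fin (2 ^ m) → Fin (2 ^ n)
  g i = encode (f (decode i))

  g-injective : Injective _≡_ _≡_ g
  g-injective {i} {j} eq = trans (sym (proj₂ (encode-surjective m i)))
    (trans (cong encode (inj (encode-injective _ _ eq))) (proj₂ (encode-surjective m j)))

-- Lower bound

module LowerBound {A : Pattern 1} {k : ℕ} (spans : Spans A (suc k)) where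
  open Spans spans

  _∈A? : ∀ a → Dec (a ∈ elements A)
  a ∈A? = DecMembership._∈?_ _≟_ a (elements A)

  indicator : Fin (suc (suc k)) → Bool
  indicator j = does (offset base j ∈A?)

  -- The two end coefficients are left out because `Recurrence` fixes them to 1, which `first∈` and
  -- `last∈` justify.
  inner : Vec Bool k
  inner = tabulate (λ j → indicator (suc (inject₁ j)))

  open Recurrence inner

  indicator-∈ : ∀ j → offset base j ∈ elements A → indicator j ≡ true
  indicator-∈ j = dec-true (offset base j ∈A?)

  ∈-indicator : ∀ j → indicator j ≡ true → offset base j ∈ elements A
  ∈-indicator j eq with offset base j ∈A?
  ... | yes p = p

  lookup-coefficients : ∀ j → lookup coefficients j ≡ indicator j
  lookup-coefficients zero    = sym (indicator-∈ zero first∈)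
  lookup-coefficients (suc j) with view j
  ... | ‵fromℕ     = trans (lookup-∷ʳ-fromℕ inner true) (sym (indicator-∈ _ last∈))
  ... | ‵inject₁ j = trans (lookup-∷ʳ-inject₁ inner true j) (Vec.lookup∘tabulate _ j)

  -- Induction on time: the other points of a completed translate were occupied earlier, and the
  -- vanishing sum over the translate fixes the value at the new point.
  agree : ∀ {S} s u → (∀ x → S x → sequence s x ≡ sequence u x) →
          ∀ t x → Occupied [ A ] S t x → sequence s x ≡ sequence u x
  agree s u eq zero    x Sx        = eq x Sx
  agree s u eq (suc t) x (inj₁ Ox) = agree s u eq t x Ox
  agree {S} s u eq (suc t) x
    (inj₂ (_ , here refl , v ∷ [] , (a , a∈A , refl) , _ , only))
    with e , refl ← within a∈A =
    subst (λ x → sequence s x ≡ sequence u x) (sym (offset-⊕ base v e))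
      (sequence-determined s u (base + v) e
        (trans (lookup-coefficients e) (indicator-∈ e a∈A)) others)
    where
    others : ∀ j → j ≢ e → lookup coefficients j ≡ true →
             sequence s (offset (base + v) j) ≡ sequence u (offset (base + v) j)
    -- Occupation is not decidable for an arbitrary `S`, but equality of bits is stable. If the
    -- values differed, the point would be vacant by induction, so `only` would force `j ≡ e`.
    others j j≢e cj = decidable-stable (_ Bool.≟ _) λ s≢u →
      j≢e (offset-injective (base + v) (trans
        (only (offset (base + v) j)
          (offset base j , ∈-indicator j (trans (sym (lookup-coefficients j)) cj) ,
           sym (offset-⊕ base v j))
          (λ Oj → s≢u (agree {S} s u eq t _ Oj)))
        (offset-⊕ base v e)))

  lowerBound : ∀ m → PercolatingSeedOfSize [ A ] m → suc k ≤ m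
  lowerBound m (S , perc , F , (S⊆F , _) , refl) = bits-injective⇒≤ restrict injective
    where
    restrict : State → Vec Bool (size F)
    restrict s = tabulate (λ p → sequence s (List.lookup (elements F) p))

    injective : Injective _≡_ _≡_ restrict
    injective {s} {u} eq = sequence-injective s u λ x →
      let t , Ox = perc x in agree s u onSeed t x Ox
      where
      onSeed : ∀ x → S x → sequence s x ≡ sequence u x
      onSeed x Sx = let x∈F = S⊆F Sx in
        -- The position of `x` in the list of seed points is the coordinate of `restrict` that
        -- records the value at `x`.
        subst (λ y → sequence s y ≡ sequence u y) (sym (lookup-index x∈F))
          (tabulate-injective eq (Any.index x∈F))

-- Combining the bounds; the window given by the convex hull

smallest : ∀ {A k} → Spans A (suc k) → IsSmallestPercolatingSize [ A ] (suc k)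
smallest spans = Interval.seedOfSize spans , LowerBound.lowerBound spans

-- The minimum and the maximum of a nonempty list are attained, so both endpoints of the window
-- belong to `A`.
spread-Spans : (A : Pattern 1) → 2 ≤ size A → Spans A (lengthConv A)
spread-Spans A@(finiteSubset ((x ∷ []) ∷ xs) _) _ = record
  { base   = lo
  ; first∈ = subst (_∈ elements A) (sym (offset-zero {∣ hi - lo ∣} lo)) (heads∈ lo∈)
  ; last∈  = subst (_∈ elements A) (cong (_∷ [])
      (trans (sym lo+spread) (cong (λ n → lo + + n) (sym (Fin.toℕ-fromℕ _))))) (heads∈ hi∈)
  ; within = inWindow
  }
  where
  ys = map head xs
  lo = min x ys
  hi = max x ys

  lo∈ : lo ∈ x ∷ ys
  lo∈ with argmin-sel id x ys
  ... | inj₁ eq = here eq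
  ... | inj₂ p  = there p

  hi∈ : hi ∈ x ∷ ys
  hi∈ with argmax-sel id x ys
  ... | inj₁ eq = here eq
  ... | inj₂ p  = there p

  bounds : All (λ z → lo ≤ℤ z × z ≤ℤ hi) (x ∷ ys)
  bounds = (min≤⊤ x ys , ⊥≤max x ys) All.∷ All.zip (min≤xs x ys , xs≤max x ys)

  heads∈ : ∀ {z} → z ∈ x ∷ ys → z ∷ [] ∈ elements A
  heads∈ z∈ with (_ ∷ []) , a∈A , refl ← ∈-map⁻ head {xs = elements A} z∈ = a∈A

  split : ∀ {i j} → i ≤ℤ j → i + + ∣ j - i ∣ ≡ j
  split {i} {j} i≤j = trans (cong (_+_ i) (ℤ.0≤i⇒+∣i∣≡i (ℤ.i≤j⇒0≤j-i i≤j))) (lemma i j)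
    where
    lemma : ∀ i j → i + (j - i) ≡ j
    lemma = solve-∀

  lo+spread : lo + + ∣ hi - lo ∣ ≡ hi
  lo+spread = split (proj₁ (All.lookup bounds hi∈))

  inWindow : ∀ {a} → a ∈ elements A → ∃[ j ] a ≡ offset {suc ∣ hi - lo ∣} lo j
  inWindow {z ∷ []} a∈A = fromℕ< (s≤s z≤spread) ,
    cong (_∷ []) (trans (sym z≡) (cong (λ n → lo + + n) (sym (Fin.toℕ-fromℕ< _))))
    where
    bound = All.lookup bounds (∈-map⁺ head a∈A)

    z≡ : lo + + ∣ z - lo ∣ ≡ z
    z≡ = split (proj₁ bound)

    z≤spread : ∣ z - lo ∣ ≤ ∣ hi - lo ∣
    z≤spread = ℤ.drop‿+≤+ (subst₂ _≤ℤ_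
      (sym (ℤ.0≤i⇒+∣i∣≡i (ℤ.i≤j⇒0≤j-i (proj₁ bound))))
      (sym (ℤ.0≤i⇒+∣i∣≡i (ℤ.i≤j⇒0≤j-i (proj₁ (All.lookup bounds hi∈)))))
      (ℤ.+-monoˡ-≤ (- lo) (proj₂ bound)))

-- A window of length 0 is a single point, which two distinct elements cannot share. The length is
-- thus a successor, the form in which both bounds are stated.
¬Spans-zero : (A : Pattern 1) → 2 ≤ size A → ¬ Spans A 0
¬Spans-zero (finiteSubset (_ ∷ []) _) (s≤s ())
¬Spans-zero (finiteSubset (a ∷ b ∷ _) (a∉ AllPairs.∷ _)) _ spans
  with zero , a≡ ← Spans.within spans (here refl)
  with zero , b≡ ← Spans.within spans (there (here refl)) = All.head a∉ (trans a≡ (sym b≡))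

theorem1 : (A : Pattern 1) → 2 ≤ size A → IsSmallestPercolatingSize [ A ] (lengthConv A)
theorem1 A 2≤ with lengthConv A | spread-Spans A 2≤
... | zero  | spans = contradiction spans (¬Spans-zero A 2≤)
... | suc k | spans = smallest spans
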